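{- Let $M$ and $P$ be terms of the symmetric $\lambda\mu$-calculus. If $M\triangleright^* P$, then $M\triangleright_{st} P$; that is, there is a standard sequence of terms starting with $M$ and ending with $P$.
   Context: Terms of the (untyped) symmetric $\lambda\mu$-calculus are given by the grammar $\mathcal T ::= x \mid \lambda x\,\mathcal T \mid (\mathcal T\;\mathcal T) \mid \mu\alpha\,\mathcal T \mid (\alpha\;\mathcal T)$, where $x,y,\dots$ range over $\lambda$-variables and $\alpha,\beta,\dots$ over $\mu$-variables ($\lambda x$ binds $x$, $\mu\alpha$ binds $\alpha$; terms are taken up to renaming of bound variables, and substitutions are capture-avoiding). One-step reduction $\triangleright$ is the closure under all term contexts of the three rules ($\beta$) $(\lambda x M\;N)\triangleright M[x:=N]$; ($\mu$) $(\mu\alpha M\;N)\triangleright \mu\alpha\, M[\alpha=_r N]$; ($\mu'$) $(M\;\mu\alpha N)\triangleright \mu\alpha\, N[\alpha=_l M]$. Here $M[\alpha=_r N]$ is obtained from $M$ by (recursively) replacing each sub-term of $M$ of the form $(\alpha\;U)$ ($\alpha$ free) by $(\alpha\;(U\;N))$, and $N[\alpha=_l M]$ is obtained from $N$ by (recursively) replacing each sub-term of $N$ of the form $(\alpha\;U)$ by $(\alpha\;(M\;U))$. $\triangleright^*$ is the reflexive transitive closure of $\triangleright$. Standard sequences. A finite sequence of terms $(M_i)_{1\le i\le n}$ ($n\ge 1$) is standard iff one of the following holds (definition by induction on the pair consisting of $n$ and the number of symbols of $M_1$, ordered lexicographically): (0) $n=1$ and $M_1$ is a $\lambda$-variable.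 (a) For all $i$, $M_i=\lambda x N_i$ (resp. for all $i$, $M_i=\mu\alpha N_i$; resp. for all $i$, $M_i=(x\;N_i)$; resp. for all $i$, $M_i=(\alpha\;N_i)$) and the sequence $(N_i)_{1\le i\le n}$ is standard. (b) There are standard sequences $(N_i)_{1\le i\le k}$ and $(P_i)_{k\le i\le n}$ such that $M_i=(N_i\;P_k)$ for $1\le i\le k$ and $M_i=(N_k\;P_i)$ for $k\le i\le n$. (c) There are a standard sequence $(N_i)_{1\le i\le k}$ and a term $Q$ such that one of the following holds (the condition on $N_{k-1}$ being void if $k=1$): (i) $M_i=(N_i\;Q)$ for $1\le i\le k$, $N_k=\lambda x P$, $N_{k-1}$ does not begin with $\lambda$, $M_{k+1}=P[x:=Q]$, and the sequence $(M_i)_{k+1\le i\le n}$ is standard; (ii) $M_i=(N_i\;Q)$ for $1\le i\le k$, $N_k=\mu\alpha P$, $N_{k-1}$ does not begin with $\mu$, $M_{k+1}=\mu\alpha\,P[\alpha=_r Q]$, and the sequence $(M_i)_{k+1\le i\le n}$ is standard; (iii) $M_i=(Q\;N_i)$ for $1\le i\le k$, $N_k=\mu\beta P$, $N_{k-1}$ does not begin with $\mu$, $M_{k+1}=\mu\beta\,P[\beta=_l Q]$, and the sequence $(M_i)_{k+1\le i\le n}$ is standard. $M\triangleright_{st}M'$ means that there is a standard sequence $(M_i)_{1\le i\le n}$ with $M=M_1$ and $M'=M_n$. -}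

module Defs where

open import Data.Nat.Base using (ℕ; suc)
open import Data.Fin.Base using (Fin; zero; suc)
open import Data.Fin.Properties using (_≟_)
open import Data.List.Base as List using (List)
open import Data.List.NonEmpty using (List⁺; [_]; head; tail; last; map; _∷ʳ_; _⁺++_; _⁺++⁺_)
open import Data.Maybe.Relation.Unary.All using (All)
open import Data.Product.Base using (∃-syntax; _×_)
open import Function.Base using (id)
open import Relation.Binary.Construct.Closure.ReflexiveTransitive using (Star)
open import Relation.Binary.PropositionalEquality.Core using (_≡_)
open import Relation.Nullary.Decidable.Core using (yes; no)
open import Relation.Nullary.Negation.Core using (¬_)

infix  4 _▷_ _▷*_ _▷st_
infixl 7 _·_
infixr 6 ƛ_ μ_ ⟨_⟩_

-- Terms up to renaming of bound variables, as well-scoped de Bruijn terms: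
-- Tm l m has its free λ-variables in Fin l and its free μ-variables in Fin m.
-- The two kinds of variable are numbered independently.  ⟨ α ⟩ M is (α M).

data Tm (l m : ℕ) : Set where
  var  : Fin l → Tm l m
  ƛ_   : Tm (suc l) m → Tm l m
  _·_  : Tm l m → Tm l m → Tm l m
  μ_   : Tm l (suc m) → Tm l m
  ⟨_⟩_ : Fin m → Tm l m → Tm l m

private
  variable
    l m l′ m′ : ℕ

lift : (Fin l → Fin l′) → Fin (suc l) → Fin (suc l′)
lift ρ zero    = zero
lift ρ (suc x) = suc (ρ x)

rename : (Fin l → Fin l′) → (Fin m → Fin m′) → Tm l m → Tm l′ m′
rename ρ θ (var x)     = var (ρ x)
rename ρ θ (ƛ M)       = ƛ rename (lift ρ) θ M
rename ρ θ (M · N)     = rename ρ θ M · rename ρ θ N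
rename ρ θ (μ M)       = μ rename ρ (lift θ) M
rename ρ θ (⟨ α ⟩ M)   = ⟨ θ α ⟩ rename ρ θ M

weakenλ : Tm l m → Tm (suc l) m
weakenλ = rename suc id

weakenμ : Tm l m → Tm l (suc m)
weakenμ = rename id suc

liftλ : (Fin l → Tm l′ m) → Fin (suc l) → Tm (suc l′) m
liftλ σ zero    = var zero
liftλ σ (suc x) = weakenλ (σ x)

liftμ : (Fin l → Tm l′ m) → Fin l → Tm l′ (suc m)
liftμ σ x = weakenμ (σ x)

subst : (Fin l → Tm l′ m) → Tm l m → Tm l′ m
subst σ (var x)   = σ x
subst σ (ƛ M)     = ƛ subst (liftλ σ) M
subst σ (M · N)   = subst σ M · subst σ N
subst σ (μ M)     = μ subst (liftμ σ) M
subst σ (⟨ α ⟩ M) = ⟨ α ⟩ subst σ M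

single : Tm l m → Fin (suc l) → Tm l m
single N zero    = N
single N (suc x) = var x

-- M [x:= N ] substitutes N for the λ-variable 0 and removes that variable
-- from the scope.

_[x:=_] : Tm (suc l) m → Tm l m → Tm l m
M [x:= N ] = subst (single N) M

-- These keep α in the scope.  N may itself contain α; the copies of N that are
-- inserted are not processed further.

_[_=r_] : Tm l m → Fin m → Tm l m → Tm l m
var x     [ α =r N ] = var x
(ƛ M)     [ α =r N ] = ƛ (M [ α =r weakenλ N ])
(M · M′)  [ α =r N ] = (M [ α =r N ]) · (M′ [ α =r N ])
(μ M)     [ α =r N ] = μ (M [ suc α =r weakenμ N ])
(⟨ β ⟩ U) [ α =r N ] with α ≟ β
... | yes _ = ⟨ β ⟩ ((U [ α =r N ]) · N)
... | no  _ = ⟨ β ⟩ (U [ α =r N ])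

_[_=l_] : Tm l m → Fin m → Tm l m → Tm l m
var x     [ α =l N ] = var x
(ƛ M)     [ α =l N ] = ƛ (M [ α =l weakenλ N ])
(M · M′)  [ α =l N ] = (M [ α =l N ]) · (M′ [ α =l N ])
(μ M)     [ α =l N ] = μ (M [ suc α =l weakenμ N ])
(⟨ β ⟩ U) [ α =l N ] with α ≟ β
... | yes _ = ⟨ β ⟩ (N · (U [ α =l N ]))
... | no  _ = ⟨ β ⟩ (U [ α =l N ])

data _▷_ {l m : ℕ} : Tm l m → Tm l m → Set where
  β-rule  : ∀ {M N} → (ƛ M) · N ▷ M [x:= N ]
  μ-rule  : ∀ {M N} → (μ M) · N ▷ μ (M [ zero =r weakenμ N ])
  μ′-rule : ∀ {M N} → M · (μ N) ▷ μ (N [ zero =l weakenμ M ])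
  ξ-ƛ     : ∀ {M M′} → M ▷ M′ → ƛ M ▷ ƛ M′
  ξ-·ˡ    : ∀ {M M′ N} → M ▷ M′ → M · N ▷ M′ · N
  ξ-·ʳ    : ∀ {M N N′} → N ▷ N′ → M · N ▷ M · N′
  ξ-μ     : ∀ {M M′} → M ▷ M′ → μ M ▷ μ M′
  ξ-⟨⟩    : ∀ {α M M′} → M ▷ M′ → ⟨ α ⟩ M ▷ ⟨ α ⟩ M′

_▷*_ : Tm l m → Tm l m → Set
_▷*_ = Star _▷_

data Beginsλ {l m : ℕ} : Tm l m → Set where
  beginsλ : ∀ {M} → Beginsλ (ƛ M)

data Beginsμ {l m : ℕ} : Tm l m → Set where
  beginsμ : ∀ {M} → Beginsμ (μ M)

-- LastNot B Ns: the last term of Ns, if there is one, does not satisfy B.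
-- Below, Ns is N₁, …, N_{k-1}, so the condition is void when k = 1.

LastNot : (Tm l m → Set) → List (Tm l m) → Set
LastNot B Ns = All (λ N → ¬ B N) (List.last Ns)

-- The definition by recursion on (length, size of the first term) is rendered
-- as an inductive predicate: each premise concerns a sequence that is smaller
-- for that measure, so the two determine the same sequences.
--
-- st-app: Ns is N₁, …, N_k and Ps is P_k, …, P_n; the term (N_k P_k) belongs
-- to both ranges of indices and appears once, as the last term of the first
-- part.
--
-- st-β, st-μ, st-μ′: Ns ∷ʳ N_k is N₁, …, N_k and Ms is M_{k+1}, …, M_n.

data Standard : {l m : ℕ} → List⁺ (Tm l m) → Set where
  st-var : (x : Fin l) → Standard {l} {m} [ var x ]
  st-ƛ   : {Ns : List⁺ (Tm (suc l) m)} → Standard Ns → Standard (map ƛ_ Ns)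
  st-μα  : {Ns : List⁺ (Tm l (suc m))} → Standard Ns → Standard (map μ_ Ns)
  st-x   : (x : Fin l) {Ns : List⁺ (Tm l m)} →
           Standard Ns → Standard (map (var x ·_) Ns)
  st-α   : (α : Fin m) {Ns : List⁺ (Tm l m)} →
           Standard Ns → Standard (map (⟨ α ⟩_) Ns)
  st-app : {Ns Ps : List⁺ (Tm l m)} → Standard Ns → Standard Ps →
           Standard (map (_· head Ps) Ns ⁺++ List.map (last Ns ·_) (tail Ps))
  st-β   : {Ns : List (Tm l m)} {P : Tm (suc l) m} {Q : Tm l m} {Ms : List⁺ (Tm l m)} →
           Standard (Ns ∷ʳ (ƛ P)) → LastNot Beginsλ Ns →
           head Ms ≡ P [x:= Q ] → Standard Ms →
           Standard (map (_· Q) (Ns ∷ʳ (ƛ P)) ⁺++⁺ Ms)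
  st-μ   : {Ns : List (Tm l m)} {P : Tm l (suc m)} {Q : Tm l m} {Ms : List⁺ (Tm l m)} →
           Standard (Ns ∷ʳ (μ P)) → LastNot Beginsμ Ns →
           head Ms ≡ μ (P [ zero =r weakenμ Q ]) → Standard Ms →
           Standard (map (_· Q) (Ns ∷ʳ (μ P)) ⁺++⁺ Ms)
  st-μ′  : {Ns : List (Tm l m)} {P : Tm l (suc m)} {Q : Tm l m} {Ms : List⁺ (Tm l m)} →
           Standard (Ns ∷ʳ (μ P)) → LastNot Beginsμ Ns →
           head Ms ≡ μ (P [ zero =l weakenμ Q ]) → Standard Ms →
           Standard (map (Q ·_) (Ns ∷ʳ (μ P)) ⁺++⁺ Ms)

_▷st_ : Tm l m → Tm l m → Set
M ▷st M′ = ∃[ Ms ] (Standard Ms × head Ms ≡ M × last Ms ≡ M′)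

{-# OPTIONS --safe #-}

-- Write M ⇓ V for evaluation of M by weak head steps to a λ- or μ-abstraction V.
-- The first part of a sequence of clause (c) is such an evaluation, so the
-- inductive relation M ↝ P, in which evaluation alternates with reduction inside
-- subterms, yields a standard sequence from M to P.  It then suffices that ↝ is
-- reflexive and absorbs one more reduction step on the right.  A contracted
-- redex can be absorbed because ↝ is compatible with both kinds of substitution.

module Submission where

open import Defs
open import Data.Nat.Base using (ℕ; suc)
open import Data.Fin.Base using (Fin; zero; suc)
open import Data.Fin.Properties using (_≟_)
open import Data.List.Base as List using (List; []; _∷_; _++_; foldl)
import Data.List.Properties as List
open import Data.List.NonEmpty as List⁺
  using (List⁺; _∷_; [_]; head; tail; last; toList; snocView; _∷ʳ′_; _∷ʳ_; _++⁺_; _⁺++_; _⁺++⁺_)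
open import Data.List.NonEmpty.Properties using (++-++⁺)
open import Data.List.Relation.Binary.Pointwise as Pointwise using (Pointwise; []; _∷_)
import Data.List.Relation.Unary.All as All
open All using (All; []; _∷_)
import Data.List.Relation.Unary.All.Properties as All
import Data.Maybe.Relation.Unary.All as Maybe
open import Data.Product.Base using (∃-syntax; _×_; _,_; map₂; proj₁; proj₂)
open import Function.Base using (id; _∘_)
open import Relation.Binary.Construct.Closure.ReflexiveTransitive using (ε; _◅_)
open import Relation.Binary.PropositionalEquality
  using (_≡_; refl; sym; trans; cong; cong₂; module ≡-Reasoning)
  renaming (subst to transport; subst₂ to transport₂)
open import Relation.Nullary.Decidable.Core using (yes; no)
open import Relation.Nullary.Negation.Core using (¬_)

private
  variable
    l m l₁ m₁ l₂ m₂ l₃ m₃ : ℕ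

-- Simultaneous substitution

-- The rules (`μ`) and (`μ′`) differ only in the side on which the argument stands; with the side as
-- a parameter, both are treated by one argument.
data Side : Set where
  right left : Side

_⟪_,_⟫ : Tm l m → Side → Tm l m → Tm l m
U ⟪ right , N ⟫ = U · N
U ⟪ left  , N ⟫ = N · U

_[_=⟨_⟩_] : Tm l m → Fin m → Side → Tm l m → Tm l m
M [ α =⟨ right ⟩ N ] = M [ α =r N ]
M [ α =⟨ left ⟩ N ]  = M [ α =l N ]

-- Outermost argument first.
Ctx : ℕ → ℕ → Set
Ctx l m = List (Side × Tm l m)

plug : Ctx l m → Tm l m → Tm l m
plug []            U = U
plug ((s , N) ∷ E) U = plug E U ⟪ s , N ⟫

-- The prefix ⟨ α ⟩ E[·] that replaces a μ-variable.
Name : ℕ → ℕ → Set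
Name l m = Fin m × Ctx l m

close : Name l m → Tm l m → Tm l m
close (α , E) U = ⟨ α ⟩ plug E U

mapᶜ : (Tm l₁ m₁ → Tm l₂ m₂) → Ctx l₁ m₁ → Ctx l₂ m₂
mapᶜ f = List.map (map₂ f)

renameᴺ : (Fin l₁ → Fin l₂) → (Fin m₁ → Fin m₂) → Name l₁ m₁ → Name l₂ m₂
renameᴺ ρ θ (α , E) = θ α , mapᶜ (rename ρ θ) E

-- One notion of substitution that covers rename, subst, =r and =l, so that
-- each substitution lemma is proved once.
record Env (l m l′ m′ : ℕ) : Set where
  constructor env
  field
    tm   : Fin l → Tm l′ m′
    name : Fin m → Name l′ m′
open Env

renameᵉ : (Fin l₂ → Fin l₃) → (Fin m₂ → Fin m₃) → Env l₁ m₁ l₂ m₂ → Env l₁ m₁ l₃ m₃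
renameᵉ ρ θ e = env (rename ρ θ ∘ tm e) (renameᴺ ρ θ ∘ name e)

⇑λ : Env l m l₁ m₁ → Env (suc l) m (suc l₁) m₁
⇑λ e .tm zero    = var zero
⇑λ e .tm (suc x) = weakenλ (tm e x)
⇑λ e .name       = renameᴺ suc id ∘ name e

⇑μ : Env l m l₁ m₁ → Env l (suc m) l₁ (suc m₁)
⇑μ e .tm           = weakenμ ∘ tm e
⇑μ e .name zero    = zero , []
⇑μ e .name (suc α) = renameᴺ id suc (name e α)

sub : Env l m l₁ m₁ → Tm l m → Tm l₁ m₁
sub e (var x)   = tm e x
sub e (ƛ M)     = ƛ sub (⇑λ e) M
sub e (M · N)   = sub e M · sub e N
sub e (μ M)     = μ sub (⇑μ e) M
sub e (⟨ α ⟩ M) = close (name e α) (sub e M)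

-- The action on names for which `close-sub` holds. The variable α becomes a prefix whose own
-- context surrounds the image of `E`, so that context stands first.
subᴺ : Env l m l₁ m₁ → Name l m → Name l₁ m₁
subᴺ e (α , E) = proj₁ (name e α) , proj₂ (name e α) ++ mapᶜ (sub e) E

mapᶜ-∘ : {f : Tm l₂ m₂ → Tm l₃ m₃} {g : Tm l₁ m₁ → Tm l₂ m₂} {h : Tm l₁ m₁ → Tm l₃ m₃} →
         (∀ M → f (g M) ≡ h M) → ∀ E → mapᶜ f (mapᶜ g E) ≡ mapᶜ h E
mapᶜ-∘ eq E = trans (sym (List.map-∘ E)) (List.map-cong (λ (s , N) → cong (s ,_) (eq N)) E)

mapᶜ-square : {f : Tm l₁ m₁ → Tm l₃ m₃} {g : Tm l m → Tm l₁ m₁}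
              {f′ : Tm l₂ m₂ → Tm l₃ m₃} {g′ : Tm l m → Tm l₂ m₂} →
              (∀ M → f (g M) ≡ f′ (g′ M)) → ∀ E → mapᶜ f (mapᶜ g E) ≡ mapᶜ f′ (mapᶜ g′ E)
mapᶜ-square eq E = trans (mapᶜ-∘ eq E) (sym (mapᶜ-∘ (λ _ → refl) E))

mapᶜ-cancel : {f : Tm l₁ m₁ → Tm l m} {g : Tm l m → Tm l₁ m₁} →
              (∀ M → f (g M) ≡ M) → ∀ E → mapᶜ f (mapᶜ g E) ≡ E
mapᶜ-cancel eq E = trans (mapᶜ-∘ eq E) (List.map-id E)

⟪⟫-rename : ∀ (ρ : Fin l₁ → Fin l₂) (θ : Fin m₁ → Fin m₂) s {U N} →
            rename ρ θ (U ⟪ s , N ⟫) ≡ rename ρ θ U ⟪ s , rename ρ θ N ⟫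
⟪⟫-rename ρ θ right = refl
⟪⟫-rename ρ θ left  = refl

⟪⟫-sub : ∀ (e : Env l m l₁ m₁) s {U N} → sub e (U ⟪ s , N ⟫) ≡ sub e U ⟪ s , sub e N ⟫
⟪⟫-sub e right = refl
⟪⟫-sub e left  = refl

plug-rename : ∀ (ρ : Fin l₁ → Fin l₂) (θ : Fin m₁ → Fin m₂) E {U} →
              rename ρ θ (plug E U) ≡ plug (mapᶜ (rename ρ θ) E) (rename ρ θ U)
plug-rename ρ θ []            = refl
plug-rename ρ θ ((s , N) ∷ E) =
  trans (⟪⟫-rename ρ θ s) (cong (_⟪ s , rename ρ θ N ⟫) (plug-rename ρ θ E))

plug-sub : ∀ (e : Env l m l₁ m₁) E {U} → sub e (plug E U) ≡ plug (mapᶜ (sub e) E) (sub e U)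
plug-sub e []            = refl
plug-sub e ((s , N) ∷ E) = trans (⟪⟫-sub e s) (cong (_⟪ s , sub e N ⟫) (plug-sub e E))

plug-++ : ∀ (E F : Ctx l m) {U} → plug (E ++ F) U ≡ plug E (plug F U)
plug-++ []            F = refl
plug-++ ((s , N) ∷ E) F = cong (_⟪ s , N ⟫) (plug-++ E F)

close-sub : ∀ (e : Env l m l₁ m₁) n {U} → sub e (close n U) ≡ close (subᴺ e n) (sub e U)
close-sub e (α , E) =
  cong (⟨ _ ⟩_) (trans (cong (plug (proj₂ (name e α))) (plug-sub e E)) (sym (plug-++ (proj₂ (name e α)) _)))

-- Fusion of substitutions

lift-lift : {ρ₂ : Fin l₂ → Fin l₃} {ρ₁ : Fin l₁ → Fin l₂} {ρ : Fin l₁ → Fin l₃} →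
            (∀ x → ρ₂ (ρ₁ x) ≡ ρ x) → ∀ x → lift ρ₂ (lift ρ₁ x) ≡ lift ρ x
lift-lift eq zero    = refl
lift-lift eq (suc x) = cong suc (eq x)

-- The composite is a separate parameter, tied to the two maps by pointwise equations, because under
-- a binder the lifted maps compose to the lifted composite only pointwise. The other fusion lemmas
-- have the same form.
rename-rename : {ρ₂ : Fin l₂ → Fin l₃} {ρ₁ : Fin l₁ → Fin l₂} {ρ : Fin l₁ → Fin l₃}
                {θ₂ : Fin m₂ → Fin m₃} {θ₁ : Fin m₁ → Fin m₂} {θ : Fin m₁ → Fin m₃} →
                (∀ x → ρ₂ (ρ₁ x) ≡ ρ x) → (∀ α → θ₂ (θ₁ α) ≡ θ α) →
                ∀ M → rename ρ₂ θ₂ (rename ρ₁ θ₁ M) ≡ rename ρ θ M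
rename-rename p q (var x)   = cong var (p x)
rename-rename p q (ƛ M)     = cong ƛ_ (rename-rename (lift-lift p) q M)
rename-rename p q (M · N)   = cong₂ _·_ (rename-rename p q M) (rename-rename p q N)
rename-rename p q (μ M)     = cong μ_ (rename-rename p (lift-lift q) M)
rename-rename p q (⟨ α ⟩ M) = cong₂ ⟨_⟩_ (q α) (rename-rename p q M)

rename-weakenλ : ∀ (ρ : Fin l₁ → Fin l₂) (θ : Fin m₁ → Fin m₂) M →
                 rename (lift ρ) θ (weakenλ M) ≡ weakenλ (rename ρ θ M)
rename-weakenλ ρ θ M = trans (rename-rename (λ _ → refl) (λ _ → refl) M)
                             (sym (rename-rename (λ _ → refl) (λ _ → refl) M))

rename-weakenμ : ∀ (ρ : Fin l₁ → Fin l₂) (θ : Fin m₁ → Fin m₂) M →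
                 rename ρ (lift θ) (weakenμ M) ≡ weakenμ (rename ρ θ M)
rename-weakenμ ρ θ M = trans (rename-rename (λ _ → refl) (λ _ → refl) M)
                             (sym (rename-rename (λ _ → refl) (λ _ → refl) M))

sub-rename : {e : Env l₂ m₂ l₃ m₃} {ρ : Fin l₁ → Fin l₂} {θ : Fin m₁ → Fin m₂} {e′ : Env l₁ m₁ l₃ m₃} →
             (∀ x → tm e (ρ x) ≡ tm e′ x) → (∀ α → name e (θ α) ≡ name e′ α) →
             ∀ M → sub e (rename ρ θ M) ≡ sub e′ M
sub-rename p q (var x)   = p x
sub-rename p q (ƛ M)     = cong ƛ_ (sub-rename
  (λ { zero → refl ; (suc x) → cong weakenλ (p x) }) (cong (renameᴺ suc id) ∘ q) M)
sub-rename p q (M · N)   = cong₂ _·_ (sub-rename p q M) (sub-rename p q N)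
sub-rename p q (μ M)     = cong μ_ (sub-rename
  (cong weakenμ ∘ p) (λ { zero → refl ; (suc α) → cong (renameᴺ id suc) (q α) }) M)
sub-rename p q (⟨ α ⟩ M) = cong₂ close (q α) (sub-rename p q M)

rename-sub : {ρ : Fin l₂ → Fin l₃} {θ : Fin m₂ → Fin m₃} {e : Env l₁ m₁ l₂ m₂} {e′ : Env l₁ m₁ l₃ m₃} →
             (∀ x → rename ρ θ (tm e x) ≡ tm e′ x) → (∀ α → renameᴺ ρ θ (name e α) ≡ name e′ α) →
             ∀ M → rename ρ θ (sub e M) ≡ sub e′ M
rename-sub p q (var x)   = p x
rename-sub {ρ = ρ} {θ} {e} p q (ƛ M) = cong ƛ_ (rename-sub
  (λ { zero    → refl
     ; (suc x) → trans (rename-weakenλ ρ θ (tm e x)) (cong weakenλ (p x)) })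
  (λ α → trans (cong (_ ,_) (mapᶜ-square (rename-weakenλ ρ θ) (proj₂ (name e α))))
               (cong (renameᴺ suc id) (q α))) M)
rename-sub p q (M · N)   = cong₂ _·_ (rename-sub p q M) (rename-sub p q N)
rename-sub {ρ = ρ} {θ} {e} p q (μ M) = cong μ_ (rename-sub
  (λ x → trans (rename-weakenμ ρ θ (tm e x)) (cong weakenμ (p x)))
  (λ { zero    → refl
     ; (suc α) → trans (cong (_ ,_) (mapᶜ-square (rename-weakenμ ρ θ) (proj₂ (name e α))))
                       (cong (renameᴺ id suc) (q α)) }) M)
rename-sub {ρ = ρ} {θ} {e} p q (⟨ α ⟩ M) =
  trans (cong (⟨ _ ⟩_) (plug-rename ρ θ (proj₂ (name e α)))) (cong₂ close (q α) (rename-sub p q M))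

-- Both sides fuse to the substitution by `renameᵉ suc id e`. The binder cases of `sub-sub` rest on
-- this lemma and its μ-analogue.
sub-weakenλ : ∀ (e : Env l m l₁ m₁) M → sub (⇑λ e) (weakenλ M) ≡ weakenλ (sub e M)
sub-weakenλ e M = trans (sub-rename {e′ = renameᵉ suc id e} (λ _ → refl) (λ _ → refl) M)
                        (sym (rename-sub (λ _ → refl) (λ _ → refl) M))

sub-weakenμ : ∀ (e : Env l m l₁ m₁) M → sub (⇑μ e) (weakenμ M) ≡ weakenμ (sub e M)
sub-weakenμ e M = trans (sub-rename {e′ = renameᵉ id suc e} (λ _ → refl) (λ _ → refl) M)
                        (sym (rename-sub (λ _ → refl) (λ _ → refl) M))

subᴺ-weakenλ : ∀ (e : Env l m l₁ m₁) n → subᴺ (⇑λ e) (renameᴺ suc id n) ≡ renameᴺ suc id (subᴺ e n)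
subᴺ-weakenλ e (α , E) = cong (_ ,_) (trans
  (cong (_ ++_) (mapᶜ-square (sub-weakenλ e) E)) (sym (List.map-++ _ (proj₂ (name e α)) _)))

subᴺ-weakenμ : ∀ (e : Env l m l₁ m₁) n → subᴺ (⇑μ e) (renameᴺ id suc n) ≡ renameᴺ id suc (subᴺ e n)
subᴺ-weakenμ e (α , E) = cong (_ ,_) (trans
  (cong (_ ++_) (mapᶜ-square (sub-weakenμ e) E)) (sym (List.map-++ _ (proj₂ (name e α)) _)))

sub-sub : {e₂ : Env l₂ m₂ l₃ m₃} {e₁ : Env l₁ m₁ l₂ m₂} {e : Env l₁ m₁ l₃ m₃} →
          (∀ x → sub e₂ (tm e₁ x) ≡ tm e x) → (∀ α → subᴺ e₂ (name e₁ α) ≡ name e α) →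
          ∀ M → sub e₂ (sub e₁ M) ≡ sub e M
sub-sub p q (var x)   = p x
sub-sub {e₂ = e₂} {e₁} p q (ƛ M) = cong ƛ_ (sub-sub
  (λ { zero    → refl
     ; (suc x) → trans (sub-weakenλ e₂ (tm e₁ x)) (cong weakenλ (p x)) })
  (λ α → trans (subᴺ-weakenλ e₂ (name e₁ α)) (cong (renameᴺ suc id) (q α))) M)
sub-sub p q (M · N)   = cong₂ _·_ (sub-sub p q M) (sub-sub p q N)
sub-sub {e₂ = e₂} {e₁} p q (μ M) = cong μ_ (sub-sub
  (λ x → trans (sub-weakenμ e₂ (tm e₁ x)) (cong weakenμ (p x)))
  (λ { zero    → refl
     ; (suc α) → trans (subᴺ-weakenμ e₂ (name e₁ α)) (cong (renameᴺ id suc) (q α)) }) M)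
sub-sub {e₂ = e₂} {e₁} p q (⟨ α ⟩ M) =
  trans (close-sub e₂ (name e₁ α)) (cong₂ close (q α) (sub-sub p q M))

sub-id : {e : Env l m l m} → (∀ x → tm e x ≡ var x) → (∀ α → name e α ≡ (α , [])) →
         ∀ M → sub e M ≡ M
sub-id p q (var x)   = p x
sub-id p q (ƛ M)     = cong ƛ_ (sub-id
  (λ { zero → refl ; (suc x) → cong weakenλ (p x) }) (cong (renameᴺ suc id) ∘ q) M)
sub-id p q (M · N)   = cong₂ _·_ (sub-id p q M) (sub-id p q N)
sub-id p q (μ M)     = cong μ_ (sub-id
  (cong weakenμ ∘ p) (λ { zero → refl ; (suc α) → cong (renameᴺ id suc) (q α) }) M)
sub-id p q (⟨ α ⟩ M) = cong₂ close (q α) (sub-id p q M)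

-- Renaming, substitution and replacement as instances of `sub`

idᵉ : Env l m l m
idᵉ = env var (_, [])

rename≡sub : ∀ (ρ : Fin l₁ → Fin l₂) (θ : Fin m₁ → Fin m₂) M →
             rename ρ θ M ≡ sub (renameᵉ ρ θ idᵉ) M
rename≡sub ρ θ M = trans (cong (rename ρ θ) (sym (sub-id (λ _ → refl) (λ _ → refl) M)))
                         (rename-sub (λ _ → refl) (λ _ → refl) M)

subst≡sub : {σ : Fin l → Tm l₁ m} {e : Env l m l₁ m} →
            (∀ x → σ x ≡ tm e x) → (∀ α → name e α ≡ (α , [])) →
            ∀ M → subst σ M ≡ sub e M
subst≡sub p q (var x)   = p x
subst≡sub p q (ƛ M)     = cong ƛ_ (subst≡sub
  (λ { zero → refl ; (suc x) → cong weakenλ (p x) }) (cong (renameᴺ suc id) ∘ q) M)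
subst≡sub p q (M · N)   = cong₂ _·_ (subst≡sub p q M) (subst≡sub p q N)
subst≡sub p q (μ M)     = cong μ_ (subst≡sub
  (cong weakenμ ∘ p) (λ { zero → refl ; (suc α) → cong (renameᴺ id suc) (q α) }) M)
subst≡sub {e = e} p q (⟨ α ⟩ M) rewrite q α = cong (⟨ α ⟩_) (subst≡sub p q M)

singleᵉ : Tm l m → Env (suc l) m l m
singleᵉ N = env (single N) (_, [])

[:=]≡sub : ∀ (M : Tm (suc l) m) N → M [x:= N ] ≡ sub (singleᵉ N) M
[:=]≡sub M N = subst≡sub (λ _ → refl) (λ _ → refl) M

replace : Fin m → Side → Tm l m → Fin m → Name l m
replace α s N β with α ≟ β
... | yes _ = β , (s , N) ∷ []
... | no  _ = β , []

replaceᵉ : Fin m → Side → Tm l m → Env l m l m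
replaceᵉ α s N = env var (replace α s N)

replace-weakenλ : ∀ (α : Fin m) s (N : Tm l m) β →
                  replace α s (weakenλ N) β ≡ renameᴺ suc id (replace α s N β)
replace-weakenλ α s N β with α ≟ β
... | yes _ = refl
... | no  _ = refl

replace-weakenμ : ∀ (α : Fin m) s (N : Tm l m) β →
                  replace (suc α) s (weakenμ N) (suc β) ≡ renameᴺ id suc (replace α s N β)
replace-weakenμ α s N β with α ≟ β
... | yes _ = refl
... | no  _ = refl

replace-⇑λ : ∀ {e : Env l m l m} {α s N} → (∀ β → replace α s N β ≡ name e β) →
             ∀ β → replace α s (weakenλ N) β ≡ name (⇑λ e) β
replace-⇑λ q β = trans (replace-weakenλ _ _ _ β) (cong (renameᴺ suc id) (q β))

replace-⇑μ : ∀ {e : Env l m l m} {α s N} → (∀ β → replace α s N β ≡ name e β) →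
             ∀ β → replace (suc α) s (weakenμ N) β ≡ name (⇑μ e) β
replace-⇑μ q zero    = refl
replace-⇑μ q (suc β) = trans (replace-weakenμ _ _ _ β) (cong (renameᴺ id suc) (q β))

var-⇑λ : {e : Env l m l m} → (∀ x → var x ≡ tm e x) → ∀ x → var x ≡ tm (⇑λ e) x
var-⇑λ p zero    = refl
var-⇑λ p (suc x) = cong weakenλ (p x)

-- The environment is fixed only pointwise: under a binder the induction meets a lifted `replaceᵉ`,
-- which agrees pointwise with the `replaceᵉ` of the weakened argument.
[=r]≡sub : ∀ {e : Env l m l m} {α N} →
           (∀ x → var x ≡ tm e x) → (∀ β → replace α right N β ≡ name e β) →
           ∀ M → M [ α =r N ] ≡ sub e M
[=r]≡sub p q (var x) = p x
[=r]≡sub {e = e} p q (ƛ M) = cong ƛ_ ([=r]≡sub (var-⇑λ {e = e} p) (replace-⇑λ {e = e} q) M)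
[=r]≡sub p q (M · M′) = cong₂ _·_ ([=r]≡sub p q M) ([=r]≡sub p q M′)
[=r]≡sub {e = e} p q (μ M) = cong μ_ ([=r]≡sub (cong weakenμ ∘ p) (replace-⇑μ {e = e} q) M)
-- Rewriting exposes `replace α right N β`, so that one test of `α ≟ β` decides both sides.
[=r]≡sub {α = α} {N} p q (⟨ β ⟩ M) rewrite sym (q β) with α ≟ β
... | yes _ = cong (λ U → ⟨ β ⟩ (U · N)) ([=r]≡sub p q M)
... | no  _ = cong (⟨ β ⟩_) ([=r]≡sub p q M)

[=l]≡sub : ∀ {e : Env l m l m} {α N} →
           (∀ x → var x ≡ tm e x) → (∀ β → replace α left N β ≡ name e β) →
           ∀ M → M [ α =l N ] ≡ sub e M
[=l]≡sub p q (var x) = p x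
[=l]≡sub {e = e} p q (ƛ M) = cong ƛ_ ([=l]≡sub (var-⇑λ {e = e} p) (replace-⇑λ {e = e} q) M)
[=l]≡sub p q (M · M′) = cong₂ _·_ ([=l]≡sub p q M) ([=l]≡sub p q M′)
[=l]≡sub {e = e} p q (μ M) = cong μ_ ([=l]≡sub (cong weakenμ ∘ p) (replace-⇑μ {e = e} q) M)
[=l]≡sub {α = α} {N} p q (⟨ β ⟩ M) rewrite sym (q β) with α ≟ β
... | yes _ = cong (λ U → ⟨ β ⟩ (N · U)) ([=l]≡sub p q M)
... | no  _ = cong (⟨ β ⟩_) ([=l]≡sub p q M)

[=]≡sub : ∀ {α} s {N} (M : Tm l m) → M [ α =⟨ s ⟩ N ] ≡ sub (replaceᵉ α s N) M
[=]≡sub right = [=r]≡sub (λ _ → refl) (λ _ → refl)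
[=]≡sub left  = [=l]≡sub (λ _ → refl) (λ _ → refl)

-- Commutation of substitution with the contracta

single-weakenλ : ∀ (N M : Tm l m) → sub (singleᵉ N) (weakenλ M) ≡ M
single-weakenλ N M = trans (sub-rename {e′ = idᵉ} (λ _ → refl) (λ _ → refl) M)
                           (sub-id (λ _ → refl) (λ _ → refl) M)

-- The μ-variable 0 does not occur in a weakened term, so nothing is replaced.
replace-zero-weakenμ : ∀ s (N : Tm l (suc m)) M → sub (replaceᵉ zero s N) (weakenμ M) ≡ weakenμ M
replace-zero-weakenμ s N M =
  trans (sub-rename {e′ = renameᵉ id suc idᵉ} (λ _ → refl) (λ _ → refl) M)
        (sym (rename≡sub id suc M))

-- Both sides fuse to the environment `e′` that sends variable 0 to `sub e N` and otherwise acts as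
-- `e`.
sub-[:=] : ∀ (e : Env l m l₁ m₁) M N → sub e (M [x:= N ]) ≡ sub (⇑λ e) M [x:= sub e N ]
sub-[:=] e M N = begin
  sub e (M [x:= N ])                         ≡⟨ cong (sub e) ([:=]≡sub M N) ⟩
  sub e (sub (singleᵉ N) M)                  ≡⟨ sub-sub {e = e′} (λ { zero → refl ; (suc x) → refl })
                                                  (λ α → cong (_ ,_) (List.++-identityʳ _)) M ⟩
  sub e′ M                                   ≡⟨ sub-sub (λ { zero → refl ; (suc x) → single-weakenλ _ (tm e x) })
                                                  (λ α → cong (_ ,_) (mapᶜ-cancel (single-weakenλ _) _)) M ⟨
  sub (singleᵉ (sub e N)) (sub (⇑λ e) M)     ≡⟨ [:=]≡sub (sub (⇑λ e) M) (sub e N) ⟨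
  sub (⇑λ e) M [x:= sub e N ]                ∎
  where
  open ≡-Reasoning
  e′ = env (λ { zero → sub e N ; (suc x) → tm e x }) (name e)

-- Both sides fuse to `e′`, which keeps μ-variable 0 but gives it the image of `N` as its one
-- argument, and otherwise acts as `⇑μ e`.
sub-[=] : ∀ (e : Env l m l₁ m₁) s M N →
          sub (⇑μ e) (M [ zero =⟨ s ⟩ weakenμ N ]) ≡ sub (⇑μ e) M [ zero =⟨ s ⟩ weakenμ (sub e N) ]
sub-[=] e s M N = begin
  sub (⇑μ e) (M [ zero =⟨ s ⟩ weakenμ N ])
    ≡⟨ cong (sub (⇑μ e)) ([=]≡sub s M) ⟩
  sub (⇑μ e) (sub (replaceᵉ zero s (weakenμ N)) M)
    ≡⟨ sub-sub {e = e′} (λ _ → refl)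
         (λ { zero    → cong (λ L → zero , (s , L) ∷ []) (sub-weakenμ e N)
            ; (suc α) → cong (_ ,_) (List.++-identityʳ _) }) M ⟩
  sub e′ M
    ≡⟨ sub-sub (λ x → replace-zero-weakenμ s _ (tm e x))
         (λ { zero    → refl
            ; (suc α) → cong (_ ,_) (mapᶜ-∘ (replace-zero-weakenμ s _) _) }) M ⟨
  sub (replaceᵉ zero s (weakenμ (sub e N))) (sub (⇑μ e) M)
    ≡⟨ [=]≡sub s (sub (⇑μ e) M) ⟨
  sub (⇑μ e) M [ zero =⟨ s ⟩ weakenμ (sub e N) ]
    ∎
  where
  open ≡-Reasoning
  e′ = env (weakenμ ∘ tm e) (λ { zero → zero , (s , weakenμ (sub e N)) ∷ [] ; (suc α) → name (⇑μ e) (suc α) })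

-- Evaluation and standard reducibility

infix 4 _⇓_ _↝_

-- A β-contractum may need further evaluation, while the contractum in `⇓-μ·` is already an
-- abstraction. Evaluation may enter either side of an application, so a term can have several
-- values.
data _⇓_ {l m : ℕ} : Tm l m → Tm l m → Set where
  ⇓-ƛ : ∀ {P} → ƛ P ⇓ ƛ P
  ⇓-μ : ∀ {P} → μ P ⇓ μ P
  ⇓-β : ∀ {N P Q V} → N ⇓ ƛ P → P [x:= Q ] ⇓ V → N · Q ⇓ V
  ⇓-μ· : ∀ s {N P Q} → N ⇓ μ P → N ⟪ s , Q ⟫ ⇓ μ (P [ zero =⟨ s ⟩ weakenμ Q ])

-- A head μ-redex enters through the evaluation in `↝-μ`: its contractum is a μ-abstraction, hence
-- so is every term reached from it. A β-contractum can lead to a term of any shape, hence `↝-β`.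
data _↝_ {l m : ℕ} : Tm l m → Tm l m → Set where
  ↝-var : ∀ x → var x ↝ var x
  ↝-ƛ   : ∀ {M P R} → M ⇓ ƛ P → P ↝ R → M ↝ ƛ R
  ↝-μ   : ∀ {M P R} → M ⇓ μ P → P ↝ R → M ↝ μ R
  ↝-·   : ∀ {M M′ N N′} → M ↝ M′ → N ↝ N′ → M · N ↝ M′ · N′
  ↝-⟨⟩  : ∀ α {M M′} → M ↝ M′ → ⟨ α ⟩ M ↝ ⟨ α ⟩ M′
  ↝-β   : ∀ {N P Q R} → N ⇓ ƛ P → P [x:= Q ] ↝ R → N · Q ↝ R

↝-refl : (M : Tm l m) → M ↝ M
↝-refl (var x)   = ↝-var x
↝-refl (ƛ M)     = ↝-ƛ ⇓-ƛ (↝-refl M)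
↝-refl (M · N)   = ↝-· (↝-refl M) (↝-refl N)
↝-refl (μ M)     = ↝-μ ⇓-μ (↝-refl M)
↝-refl (⟨ α ⟩ M) = ↝-⟨⟩ α (↝-refl M)

-- Compatibility with substitution

⇓-sub : ∀ (e : Env l m l₁ m₁) {M V} → M ⇓ V → sub e M ⇓ sub e V
⇓-sub e ⇓-ƛ = ⇓-ƛ
⇓-sub e ⇓-μ = ⇓-μ
⇓-sub e (⇓-β {P = P} {Q} N⇓ƛP P[Q]⇓V) =
  ⇓-β (⇓-sub e N⇓ƛP) (transport (_⇓ _) (sub-[:=] e P Q) (⇓-sub e P[Q]⇓V))
⇓-sub e (⇓-μ· s {P = P} {Q} N⇓μP) =
  transport₂ _⇓_ (sym (⟪⟫-sub e s)) (cong μ_ (sym (sub-[=] e s P Q))) (⇓-μ· s (⇓-sub e N⇓μP))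

↝-⟪⟫ : ∀ s {M M′ N N′ : Tm l m} → M ↝ M′ → N ↝ N′ → M ⟪ s , N ⟫ ↝ M′ ⟪ s , N′ ⟫
↝-⟪⟫ right d d′ = ↝-· d d′
↝-⟪⟫ left  d d′ = ↝-· d′ d

_↝ᶜ_ : Ctx l m → Ctx l m → Set
_↝ᶜ_ = Pointwise (λ (s , N) (s′ , N′) → s ≡ s′ × N ↝ N′)

_↝ᴺ_ : Name l m → Name l m → Set
(α , E) ↝ᴺ (α′ , E′) = α ≡ α′ × E ↝ᶜ E′

record _↝ᵉ_ (e e′ : Env l m l₁ m₁) : Set where
  field
    tm↝   : ∀ x → tm e x ↝ tm e′ x
    name↝ : ∀ α → name e α ↝ᴺ name e′ α
open _↝ᵉ_

↝-plug : ∀ {E E′ : Ctx l m} {U U′} → E ↝ᶜ E′ → U ↝ U′ → plug E U ↝ plug E′ U′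
↝-plug []                          d = d
↝-plug (_∷_ {x = s , _} (refl , d′) E↝E′) d = ↝-⟪⟫ s (↝-plug E↝E′ d) d′

↝-close : ∀ (n n′ : Name l m) {U U′} → n ↝ᴺ n′ → U ↝ U′ → close n U ↝ close n′ U′
↝-close _ _ (refl , E↝E′) d = ↝-⟨⟩ _ (↝-plug E↝E′ d)

↝-sub-β : ∀ (e : Env l m l₁ m₁) {N P Q R} →
          N ⇓ ƛ P → sub e (P [x:= Q ]) ↝ R → sub e (N · Q) ↝ R
↝-sub-β e {P = P} {Q} N⇓ƛP d = ↝-β (⇓-sub e N⇓ƛP) (transport (_↝ _) (sub-[:=] e P Q) d)

-- The case of a fixed environment comes first: through `rename≡sub` it yields `↝-rename`, which is
-- what carries `e ↝ᵉ e′` under binders in `↝-sub`.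
↝-subˡ : ∀ (e : Env l m l₁ m₁) {M M′} → M ↝ M′ → sub e M ↝ sub e M′
↝-subˡ e (↝-var x)     = ↝-refl (tm e x)
↝-subˡ e (↝-ƛ M⇓ƛP d)  = ↝-ƛ (⇓-sub e M⇓ƛP) (↝-subˡ (⇑λ e) d)
↝-subˡ e (↝-μ M⇓μP d)  = ↝-μ (⇓-sub e M⇓μP) (↝-subˡ (⇑μ e) d)
↝-subˡ e (↝-· d d′)    = ↝-· (↝-subˡ e d) (↝-subˡ e d′)
↝-subˡ e (↝-⟨⟩ α d)    = ↝-close (name e α) (name e α) (refl , Pointwise.refl (refl , ↝-refl _)) (↝-subˡ e d)
↝-subˡ e (↝-β N⇓ƛP d)  = ↝-sub-β e N⇓ƛP (↝-subˡ e d)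

↝-rename : ∀ (ρ : Fin l → Fin l₁) (θ : Fin m → Fin m₁) {M M′} → M ↝ M′ → rename ρ θ M ↝ rename ρ θ M′
↝-rename ρ θ d = transport₂ _↝_ (sym (rename≡sub ρ θ _)) (sym (rename≡sub ρ θ _)) (↝-subˡ _ d)

↝ᴺ-rename : ∀ (ρ : Fin l → Fin l₁) (θ : Fin m → Fin m₁) {n n′} → n ↝ᴺ n′ → renameᴺ ρ θ n ↝ᴺ renameᴺ ρ θ n′
↝ᴺ-rename ρ θ (α≡α′ , E↝E′) =
  cong θ α≡α′ , Pointwise.map⁺ _ _ (Pointwise.map (λ (s≡s′ , d) → s≡s′ , ↝-rename ρ θ d) E↝E′)

↝ᵉ-⇑λ : {e e′ : Env l m l₁ m₁} → e ↝ᵉ e′ → ⇑λ e ↝ᵉ ⇑λ e′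
↝ᵉ-⇑λ r .tm↝ zero    = ↝-var zero
↝ᵉ-⇑λ r .tm↝ (suc x) = ↝-rename suc id (tm↝ r x)
↝ᵉ-⇑λ r .name↝ α     = ↝ᴺ-rename suc id (name↝ r α)

↝ᵉ-⇑μ : {e e′ : Env l m l₁ m₁} → e ↝ᵉ e′ → ⇑μ e ↝ᵉ ⇑μ e′
↝ᵉ-⇑μ r .tm↝ x         = ↝-rename id suc (tm↝ r x)
↝ᵉ-⇑μ r .name↝ zero    = refl , []
↝ᵉ-⇑μ r .name↝ (suc α) = ↝ᴺ-rename id suc (name↝ r α)

-- Evaluations are carried out under `e`, where they survive because substitution keeps
-- abstractions; the passage from `e` to `e′` happens at the variables and names.
↝-sub : {e e′ : Env l m l₁ m₁} → e ↝ᵉ e′ → ∀ {M M′} → M ↝ M′ → sub e M ↝ sub e′ M′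
↝-sub r (↝-var x)    = tm↝ r x
↝-sub r (↝-ƛ M⇓ƛP d) = ↝-ƛ (⇓-sub _ M⇓ƛP) (↝-sub (↝ᵉ-⇑λ r) d)
↝-sub r (↝-μ M⇓μP d) = ↝-μ (⇓-sub _ M⇓μP) (↝-sub (↝ᵉ-⇑μ r) d)
↝-sub r (↝-· d d′)   = ↝-· (↝-sub r d) (↝-sub r d′)
↝-sub r (↝-⟨⟩ α d)   = ↝-close _ _ (name↝ r α) (↝-sub r d)
↝-sub r (↝-β N⇓ƛP d) = ↝-sub-β _ N⇓ƛP (↝-sub r d)

↝-[:=] : ∀ {M M′ : Tm (suc l) m} {N N′} → M ↝ M′ → N ↝ N′ → M [x:= N ] ↝ M′ [x:= N′ ]
↝-[:=] {M = M} {M′} {N} {N′} d d′ =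
  transport₂ _↝_ (sym ([:=]≡sub M N)) (sym ([:=]≡sub M′ N′)) (↝-sub single↝ d)
  where
  single↝ : singleᵉ N ↝ᵉ singleᵉ N′
  single↝ .tm↝ zero    = d′
  single↝ .tm↝ (suc x) = ↝-var x
  single↝ .name↝ α     = refl , []

↝-[=] : ∀ α s {M M′ N N′ : Tm l m} → M ↝ M′ → N ↝ N′ → M [ α =⟨ s ⟩ N ] ↝ M′ [ α =⟨ s ⟩ N′ ]
↝-[=] α s {M} {M′} {N} {N′} d d′ =
  transport₂ _↝_ (sym ([=]≡sub s M)) (sym ([=]≡sub s M′)) (↝-sub replace↝ d)
  where
  replace↝ : replaceᵉ α s N ↝ᵉ replaceᵉ α s N′
  replace↝ .tm↝ = ↝-var
  replace↝ .name↝ β with α ≟ β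
  ... | yes _ = refl , (refl , d′) ∷ []
  ... | no  _ = refl , []

-- Absorption of a reduction step

-- A derivation ending in an abstraction is a series of `↝-β` above one `↝-ƛ`; the β-contractions
-- are absorbed into the evaluation.
ƛ-inv : ∀ {M : Tm l m} {R} → M ↝ ƛ R → ∃[ P ] (M ⇓ ƛ P × P ↝ R)
ƛ-inv (↝-ƛ M⇓ƛP d) = _ , M⇓ƛP , d
ƛ-inv (↝-β N⇓ƛP d) = let _ , ev , d′ = ƛ-inv d in _ , ⇓-β N⇓ƛP ev , d′

μ-inv : ∀ {M : Tm l m} {R} → M ↝ μ R → ∃[ P ] (M ⇓ μ P × P ↝ R)
μ-inv (↝-μ M⇓μP d) = _ , M⇓μP , d
μ-inv (↝-β N⇓ƛP d) = let _ , ev , d′ = μ-inv d in _ , ⇓-β N⇓ƛP ev , d′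

↝-μ-rule : ∀ s {M N Q : Tm l m} {R} → M ↝ μ R → N ↝ Q → M ⟪ s , N ⟫ ↝ μ (R [ zero =⟨ s ⟩ weakenμ Q ])
↝-μ-rule s d d′ =
  let _ , ev , d₀ = μ-inv d in ↝-μ (⇓-μ· s ev) (↝-[=] zero s d₀ (↝-rename id suc d′))

-- A step inside a subterm goes to the premise that produced this subterm. If an application reached
-- by `↝-·` is itself contracted, inversion supplies an evaluation to the abstraction, so the
-- contraction moves forward and the inner reductions follow it, by compatibility with substitution.
↝-▷ : ∀ {M N P : Tm l m} → M ↝ N → N ▷ P → M ↝ P
↝-▷ (↝-β N⇓ƛP d) r           = ↝-β N⇓ƛP (↝-▷ d r)
↝-▷ (↝-ƛ M⇓ƛP d) (ξ-ƛ r)     = ↝-ƛ M⇓ƛP (↝-▷ d r)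
↝-▷ (↝-μ M⇓μP d) (ξ-μ r)     = ↝-μ M⇓μP (↝-▷ d r)
↝-▷ (↝-⟨⟩ α d)   (ξ-⟨⟩ r)    = ↝-⟨⟩ α (↝-▷ d r)
↝-▷ (↝-· d d′)   (ξ-·ˡ r)    = ↝-· (↝-▷ d r) d′
↝-▷ (↝-· d d′)   (ξ-·ʳ r)    = ↝-· d (↝-▷ d′ r)
↝-▷ (↝-· d d′)   β-rule      = let _ , ev , d₀ = ƛ-inv d in ↝-β ev (↝-[:=] d₀ d′)
↝-▷ (↝-· d d′)   μ-rule      = ↝-μ-rule right d d′
↝-▷ (↝-· d d′)   μ′-rule     = ↝-μ-rule left d′ d

↝-▷* : ∀ {M N P : Tm l m} → M ↝ N → N ▷* P → M ↝ P
↝-▷* d ε        = d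
↝-▷* d (r ◅ rs) = ↝-▷* (↝-▷ d r) rs

-- Standard sequences

module _ {A : Set} where

  -- `last` goes through `snocView` and does not recurse along the list; this fold does.
  lastFrom : A → List A → A
  lastFrom = foldl (λ _ y → y)

  last≡lastFrom : ∀ x (xs : List A) → last (x ∷ xs) ≡ lastFrom x xs
  last≡lastFrom x xs with snocView (x ∷ xs)
  ... | []       ∷ʳ′ y = refl
  ... | (_ ∷ ys) ∷ʳ′ y = sym (List.foldl-∷ʳ _ _ y ys)

  last-⁺++⁺ : ∀ (xs ys : List⁺ A) → last (xs ⁺++⁺ ys) ≡ last ys
  last-⁺++⁺ (x ∷ xs) (y ∷ ys) = begin
    last (x ∷ xs ++ y ∷ ys)      ≡⟨ last≡lastFrom x (xs ++ y ∷ ys) ⟩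
    lastFrom x (xs ++ y ∷ ys)    ≡⟨ List.foldl-++ _ x xs (y ∷ ys) ⟩
    lastFrom y ys                ≡⟨ last≡lastFrom y ys ⟨
    last (y ∷ ys)                ∎
    where open ≡-Reasoning

  last-++⁺ : ∀ xs (ys : List⁺ A) → last (xs ++⁺ ys) ≡ last ys
  last-++⁺ []       ys = refl
  last-++⁺ (x ∷ xs) ys = trans (last-⁺++⁺ [ x ] (xs ++⁺ ys)) (last-++⁺ xs ys)

  -- Clause (c) joins nonempty sequences, whereas the evaluation prefixes used below may be empty.
  ⁺++⁺≡++⁺ : ∀ x xs (ys : List⁺ A) → (x ∷ xs) ⁺++⁺ ys ≡ (x ∷ xs) ++⁺ ys
  ⁺++⁺≡++⁺ x []        (y ∷ ys) = refl
  ⁺++⁺≡++⁺ x (x′ ∷ xs) ys       = cong (λ zs → x ∷ toList zs) (⁺++⁺≡++⁺ x′ xs ys)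

  ++⁺-[] : ∀ xs (y : A) → xs ++⁺ [ y ] ≡ xs ∷ʳ y
  ++⁺-[] []            y = refl
  ++⁺-[] (x ∷ [])      y = refl
  ++⁺-[] (x ∷ x′ ∷ xs) y = cong (λ zs → x ∷ toList zs) (++⁺-[] (x′ ∷ xs) y)

module _ {A B : Set} where

  lastFrom-map : ∀ (f : A → B) x xs → lastFrom (f x) (List.map f xs) ≡ f (lastFrom x xs)
  lastFrom-map f x []       = refl
  lastFrom-map f x (y ∷ xs) = lastFrom-map f y xs

  last-map : ∀ (f : A → B) xs → last (List⁺.map f xs) ≡ f (last xs)
  last-map f (x ∷ xs) = begin
    last (f x ∷ List.map f xs)        ≡⟨ last≡lastFrom (f x) (List.map f xs) ⟩
    lastFrom (f x) (List.map f xs)    ≡⟨ lastFrom-map f x xs ⟩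
    f (lastFrom x xs)                 ≡⟨ cong f (last≡lastFrom x xs) ⟨
    f (last (x ∷ xs))                 ∎
    where open ≡-Reasoning

  -- The shape of clause (b): `head ys` is dropped because its image is already present as
  -- `f (last xs)`, which is also the last term when `tail ys` is empty.
  last-map-++-map : ∀ (f g : A → B) xs ys → f (last xs) ≡ g (head ys) →
                    last (List⁺.map f xs ⁺++ List.map g (tail ys)) ≡ g (last ys)
  last-map-++-map f g (x ∷ xs) (y ∷ ys) fx≡gy = begin
    last (f x ∷ List.map f xs ++ List.map g ys)                 ≡⟨ last≡lastFrom (f x) (List.map f xs ++ List.map g ys) ⟩
    lastFrom (f x) (List.map f xs ++ List.map g ys)             ≡⟨ List.foldl-++ _ (f x) (List.map f xs) _ ⟩
    lastFrom (lastFrom (f x) (List.map f xs)) (List.map g ys)   ≡⟨ cong (λ z → lastFrom z (List.map g ys)) z≡gy ⟩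
    lastFrom (g y) (List.map g ys)                              ≡⟨ last≡lastFrom (g y) (List.map g ys) ⟨
    last (List⁺.map g (y ∷ ys))                                 ≡⟨ last-map g (y ∷ ys) ⟩
    g (last (y ∷ ys))                                           ∎
    where
    open ≡-Reasoning
    z≡gy = trans (sym (last≡lastFrom (f x) (List.map f xs))) (trans (last-map f (x ∷ xs)) fx≡gy)

-- Standard sequences from evaluations and from `↝`

std-refl : (M : Tm l m) → Standard [ M ]
std-refl (var x)   = st-var x
std-refl (ƛ M)     = st-ƛ (std-refl M)
std-refl (M · N)   = st-app (std-refl M) (std-refl N)
std-refl (μ M)     = st-μα (std-refl M)
std-refl (⟨ α ⟩ M) = st-α α (std-refl M)

data IsApp {l m : ℕ} : Tm l m → Set where
  isApp : ∀ {M N} → IsApp (M · N)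

isApp-⟪⟫ : ∀ s {U N : Tm l m} → IsApp (U ⟪ s , N ⟫)
isApp-⟪⟫ right = isApp
isApp-⟪⟫ left  = isApp

lastNot : {B : Tm l m → Set} → (∀ {M} → IsApp M → ¬ B M) → ∀ {Ns} → All IsApp Ns → LastNot B Ns
lastNot IsApp⇒¬B apps = Maybe.map IsApp⇒¬B (All.last⁺ apps)

-- Since every term of the prefix is an application, V is the first
-- abstraction of the sequence whenever V is one: this yields the side
-- conditions of clause (c).
record Prefix (M V : Tm l m) : Set where
  field
    terms  : List (Tm l m)
    apps   : All IsApp terms
    extend : ∀ {Ms} → head Ms ≡ V → Standard Ms → Standard (terms ++⁺ Ms) × head (terms ++⁺ Ms) ≡ M

  -- Continuing with `V` alone gives the sequence that clause (c) takes as its first premise.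
  standard-∷ʳ : Standard (terms ∷ʳ V) × head (terms ∷ʳ V) ≡ M
  standard-∷ʳ =
    transport (λ Ms → Standard Ms × head Ms ≡ M) (++⁺-[] terms V) (extend refl (std-refl V))
open Prefix

prefix-refl : {V : Tm l m} → Prefix V V
prefix-refl .terms             = []
prefix-refl .apps              = []
prefix-refl .extend head≡V std = std , head≡V

prefix-trans : {M W V : Tm l m} → Prefix M W → Prefix W V → Prefix M V
prefix-trans p q .terms = terms p ++ terms q
prefix-trans p q .apps  = All.++⁺ (apps p) (apps q)
prefix-trans p q .extend head≡V std =
  let std′ , head≡W = extend q head≡V std
  in transport (λ Ms → Standard Ms × head Ms ≡ _) (sym (++-++⁺ (terms p))) (extend p head≡W std′)

-- The common form of the three cases of clause (c), with `f` supplying the argument. The redex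
-- `f V` belongs to the new prefix; the contractum `W` opens the continuation.
prefix-contract : (f : Tm l m → Tm l m) → (∀ U → IsApp (f U)) → ∀ {N V W} (p : Prefix N V) →
                  (∀ {Ms} → head Ms ≡ W → Standard Ms → Standard (List⁺.map f (terms p ∷ʳ V) ⁺++⁺ Ms)) →
                  Prefix (f N) W
prefix-contract f app {V = V} p std⁺ .terms = toList (List⁺.map f (terms p ∷ʳ V))
prefix-contract f app {V = V} p std⁺ .apps  = All.map⁺ (All.universal app (toList (terms p ∷ʳ V)))
prefix-contract f app {V = V} p std⁺ .extend head≡W std =
  transport Standard (⁺++⁺≡++⁺ _ (tail (List⁺.map f (terms p ∷ʳ V))) _) (std⁺ head≡W std) ,
  cong f (proj₂ (standard-∷ʳ p))

prefix-β : ∀ {N P} {Q : Tm l m} → Prefix N (ƛ P) → Prefix (N · Q) (P [x:= Q ])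
prefix-β {Q = Q} p = prefix-contract (_· Q) (λ _ → isApp) p
  (st-β (proj₁ (standard-∷ʳ p)) (lastNot (λ { isApp () }) (apps p)))

st-μ⟪⟫ : ∀ s {Ns P} {Q : Tm l m} {Ms} → Standard (Ns ∷ʳ (μ P)) → LastNot Beginsμ Ns →
         head Ms ≡ μ (P [ zero =⟨ s ⟩ weakenμ Q ]) → Standard Ms →
         Standard (List⁺.map (_⟪ s , Q ⟫) (Ns ∷ʳ (μ P)) ⁺++⁺ Ms)
st-μ⟪⟫ right = st-μ
st-μ⟪⟫ left  = st-μ′

prefix-μ : ∀ s {N P} {Q : Tm l m} → Prefix N (μ P) → Prefix (N ⟪ s , Q ⟫) (μ (P [ zero =⟨ s ⟩ weakenμ Q ]))
prefix-μ s {Q = Q} p = prefix-contract (_⟪ s , Q ⟫) (λ _ → isApp-⟪⟫ s) p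
  (st-μ⟪⟫ s (proj₁ (standard-∷ʳ p)) (lastNot (λ { isApp () }) (apps p)))

⇓⇒prefix : ∀ {M V : Tm l m} → M ⇓ V → Prefix M V
⇓⇒prefix ⇓-ƛ               = prefix-refl
⇓⇒prefix ⇓-μ               = prefix-refl
⇓⇒prefix (⇓-β N⇓ƛP P[Q]⇓V) = prefix-trans (prefix-β (⇓⇒prefix N⇓ƛP)) (⇓⇒prefix P[Q]⇓V)
⇓⇒prefix (⇓-μ· s N⇓μP)     = prefix-μ s (⇓⇒prefix N⇓μP)

prefix-▷st : ∀ {M V R : Tm l m} → Prefix M V → V ▷st R → M ▷st R
prefix-▷st p (Ms , std , head≡V , last≡R) =
  let std′ , head≡M = extend p head≡V std
  in terms p ++⁺ Ms , std′ , head≡M , trans (last-++⁺ (terms p) Ms) last≡R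

▷st-map : (f : Tm l m → Tm l₁ m₁) → (∀ {Ms} → Standard Ms → Standard (List⁺.map f Ms)) →
          ∀ {M R} → M ▷st R → f M ▷st f R
▷st-map f std-map (Ms , std , head≡M , last≡R) =
  List⁺.map f Ms , std-map std , cong f head≡M , trans (last-map f Ms) (cong f last≡R)

▷st-· : ∀ {M M′ N N′ : Tm l m} → M ▷st M′ → N ▷st N′ → M · N ▷st M′ · N′
▷st-· (Ms , std , head≡M , last≡M′) (Ns , std′ , head≡N , last≡N′) =
  _ , st-app std std′ , cong₂ _·_ head≡M head≡N ,
  trans (last-map-++-map (_· head Ns) (last Ms ·_) Ms Ns refl) (cong₂ _·_ last≡M′ last≡N′)

↝⇒▷st : ∀ {M R : Tm l m} → M ↝ R → M ▷st R
↝⇒▷st (↝-var x)    = [ var x ] , st-var x , refl , refl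
↝⇒▷st (↝-ƛ M⇓ƛP d) = prefix-▷st (⇓⇒prefix M⇓ƛP) (▷st-map ƛ_ st-ƛ (↝⇒▷st d))
↝⇒▷st (↝-μ M⇓μP d) = prefix-▷st (⇓⇒prefix M⇓μP) (▷st-map μ_ st-μα (↝⇒▷st d))
↝⇒▷st (↝-· d d′)   = ▷st-· (↝⇒▷st d) (↝⇒▷st d′)
↝⇒▷st (↝-⟨⟩ α d)   = ▷st-map (⟨ α ⟩_) (st-α α) (↝⇒▷st d)
↝⇒▷st (↝-β N⇓ƛP d) = prefix-▷st (prefix-β (⇓⇒prefix N⇓ƛP)) (↝⇒▷st d)

theorem5p4 : ∀ {l m : ℕ} (M P : Tm l m) → M ▷* P → M ▷st P
theorem5p4 M P M▷*P = ↝⇒▷st (↝-▷* (↝-refl M) M▷*P)
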